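{- Let $a_0,a_1,\alpha,\beta,u,v\in\mathbb{R}$ with $\alpha\beta\neq 0$, $uv\neq 0$ and $|a_0|+|a_1|\neq 0$, and let $(a_{n,k})_{0\le k\le n}$ be the binary binomial interpolated triangle with parameters $(a_0,a_1,\alpha,\beta;u,v)$. Let $s_n=\sum_{k=0}^{n}a_{n,k}$ be the sum of the entries of row $n$. Then the sequence $(s_n)_{n\ge 0}$ satisfies the fourth order linear homogeneous recurrence $$s_{n} = (\alpha+\mathcal{A})s_{n-1}+(\beta-\alpha \mathcal{A}+\mathcal{B})s_{n-2}-(\alpha \mathcal{B}+\beta \mathcal{A})s_{n-3}-\beta \mathcal{B}\, s_{n-4}\qquad\text{for all } n\ge 4,$$ where $\mathcal{A}=u\alpha+2v$ and $\mathcal{B}=u^2\beta-uv\alpha-v^2$.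
   Context: The binary binomial interpolated triangle with parameters $(a_0,a_1,\alpha,\beta;u,v)$ is the array of real numbers $a_{n,k}$ ($0\le k\le n$) defined as follows. Its left diagonal is $a_{n,0}=a_n$, where $(a_n)_{n\ge0}$ has initial values $a_0,a_1$ and satisfies $a_n=\alpha a_{n-1}+\beta a_{n-2}$ for $n\ge 2$. The other entries are given by $a_{n,k}=u\,a_{n,k-1}+v\,a_{n-1,k-1}$ for $1\le k\le n$. -}

module Defs where

open import Algebra.Bundles using (CommutativeRing)
import Algebra.Definitions.RawMonoid as RawMonoidDefinitions
open import Data.Fin.Base using (toℕ)
open import Data.Fin.Properties using (toℕ≤pred[n])
open import Data.Nat.Base as ℕ using (ℕ; zero; suc; s≤s⁻¹)
import Data.Nat.Properties as ℕ
open import Data.Product.Base using (_×_; _,_; ∃; proj₁; proj₂)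
open import Data.Rational.Base as ℚ using (ℚ; 0ℚ; 1ℚ; ½)
import Data.Rational.Properties as ℚ
open import Data.Rational.Solver using (module +-*-Solver)
open import Data.Sum.Base using (inj₁; inj₂)
open import Level using (0ℓ)
open import Relation.Binary.PropositionalEquality
  using (_≡_; refl; sym; trans; cong; subst)
open import Relation.Nullary.Negation.Core using (¬_)

private
  0<½ : 0ℚ ℚ.< ½
  0<½ = ℚ.positive⁻¹ ½

  0<1 : 0ℚ ℚ.< 1ℚ
  0<1 = ℚ.positive⁻¹ 1ℚ

  0<p*q : ∀ {p q} → 0ℚ ℚ.< p → 0ℚ ℚ.< q → 0ℚ ℚ.< p ℚ.* q
  0<p*q {p} {q} 0<p 0<q =
    ℚ.positive⁻¹ (p ℚ.* q) {{ℚ.pos*pos⇒pos p {{ℚ.positive 0<p}} q {{ℚ.positive 0<q}}}}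

  half+half : ∀ p → p ℚ.* ½ ℚ.+ p ℚ.* ½ ≡ p
  half+half p = trans (sym (ℚ.*-distribˡ-+ p ½ ½)) (ℚ.*-identityʳ p)

  ∣p-q∣≡∣q-p∣ : ∀ p q → ℚ.∣ p ℚ.- q ∣ ≡ ℚ.∣ q ℚ.- p ∣
  ∣p-q∣≡∣q-p∣ p q = trans (sym (ℚ.∣-p∣≡∣p∣ (p ℚ.- q)))
    (cong ℚ.∣_∣ (solve 2 (λ a b → :- (a :- b) := b :- a) refl p q))
    where open +-*-Solver

  ∣p∣-∣q∣≤∣p-q∣ : ∀ p q → ℚ.∣ p ∣ ℚ.- ℚ.∣ q ∣ ℚ.≤ ℚ.∣ p ℚ.- q ∣
  ∣p∣-∣q∣≤∣p-q∣ p q = begin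
    ℚ.∣ p ∣ ℚ.- ℚ.∣ q ∣                          ≡⟨ cong (λ r → ℚ.∣ r ∣ ℚ.- ℚ.∣ q ∣) (p≡p-q+q p q) ⟩
    ℚ.∣ p ℚ.- q ℚ.+ q ∣ ℚ.- ℚ.∣ q ∣              ≤⟨ ℚ.+-monoˡ-≤ (ℚ.- ℚ.∣ q ∣) (ℚ.∣p+q∣≤∣p∣+∣q∣ (p ℚ.- q) q) ⟩
    ℚ.∣ p ℚ.- q ∣ ℚ.+ ℚ.∣ q ∣ ℚ.- ℚ.∣ q ∣        ≡⟨ p+q-q≡p ℚ.∣ p ℚ.- q ∣ ℚ.∣ q ∣ ⟩
    ℚ.∣ p ℚ.- q ∣                                ∎
    where
    open ℚ.≤-Reasoning
    open +-*-Solver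
    p≡p-q+q : ∀ p q → p ≡ p ℚ.- q ℚ.+ q
    p≡p-q+q = solve 2 (λ a b → a := a :- b :+ b) refl
    p+q-q≡p : ∀ p q → p ℚ.+ q ℚ.- q ≡ p
    p+q-q≡p = solve 2 (λ a b → a :+ b :- b := a) refl

  ∣∣p∣-∣q∣∣≤∣p-q∣ : ∀ p q → ℚ.∣ ℚ.∣ p ∣ ℚ.- ℚ.∣ q ∣ ∣ ℚ.≤ ℚ.∣ p ℚ.- q ∣
  ∣∣p∣-∣q∣∣≤∣p-q∣ p q with ℚ.∣p∣≡p∨∣p∣≡-p (ℚ.∣ p ∣ ℚ.- ℚ.∣ q ∣)
  ... | inj₁ eq = subst (ℚ._≤ ℚ.∣ p ℚ.- q ∣) (sym eq) (∣p∣-∣q∣≤∣p-q∣ p q)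
  ... | inj₂ eq = begin
    ℚ.∣ ℚ.∣ p ∣ ℚ.- ℚ.∣ q ∣ ∣    ≡⟨ eq ⟩
    ℚ.- (ℚ.∣ p ∣ ℚ.- ℚ.∣ q ∣)    ≡⟨ solve 2 (λ a b → :- (a :- b) := b :- a) refl ℚ.∣ p ∣ ℚ.∣ q ∣ ⟩
    ℚ.∣ q ∣ ℚ.- ℚ.∣ p ∣          ≤⟨ ∣p∣-∣q∣≤∣p-q∣ q p ⟩
    ℚ.∣ q ℚ.- p ∣                ≡⟨ ∣p-q∣≡∣q-p∣ q p ⟩
    ℚ.∣ p ℚ.- q ∣                ∎
    where
    open ℚ.≤-Reasoning
    open +-*-Solver

-- Families of rationals tending to 0 along an index set I in which `N ⊑ i`
-- says that i lies in the N-th tail; used for one index and for pairs.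

module Limits {I : Set} (_⊑_ : ℕ → I → Set) (⊑-weaken : ∀ {M N : ℕ} {i : I} → M ℕ.≤ N → N ⊑ i → M ⊑ i) where

  record Small (f : I → ℚ) : Set where
    constructor mkSmall
    field
      below : ∀ ε → 0ℚ ℚ.< ε → ∃ λ N → ∀ i → N ⊑ i → ℚ.∣ f i ∣ ℚ.< ε

  open Small public

  record Bounded (g : I → ℚ) : Set where
    constructor mkBounded
    field
      bound      : ℚ
      0<bound    : 0ℚ ℚ.< bound
      from       : ℕ
      boundedBy  : ∀ i → from ⊑ i → ℚ.∣ g i ∣ ℚ.< bound

  dominated : ∀ {f g} → (∀ i → ℚ.∣ g i ∣ ℚ.≤ ℚ.∣ f i ∣) → Small f → Small g
  dominated g≤f f→0 .below ε 0<ε = let N , f<ε = f→0 .below ε 0<ε in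
    N , λ i N⊑i → ℚ.≤-<-trans (g≤f i) (f<ε i N⊑i)

  respects : ∀ {f g} → (∀ i → g i ≡ f i) → Small f → Small g
  respects g≡f = dominated (λ i → ℚ.≤-reflexive (cong ℚ.∣_∣ (g≡f i)))

  small-0 : ∀ {f} → (∀ i → f i ≡ 0ℚ) → Small f
  small-0 f≡0 .below ε 0<ε =
    0 , λ i _ → subst (λ p → ℚ.∣ p ∣ ℚ.< ε) (sym (f≡0 i)) 0<ε

  small-+ : ∀ {f g} → Small f → Small g → Small (λ i → f i ℚ.+ g i)
  small-+ {f} {g} f→0 g→0 .below ε 0<ε
    with f→0 .below (ε ℚ.* ½) (0<p*q 0<ε 0<½) | g→0 .below (ε ℚ.* ½) (0<p*q 0<ε 0<½)
  ... | M , f< | N , g< = M ℕ.⊔ N , λ i M⊔N⊑i → begin-strict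
    ℚ.∣ f i ℚ.+ g i ∣          ≤⟨ ℚ.∣p+q∣≤∣p∣+∣q∣ (f i) (g i) ⟩
    ℚ.∣ f i ∣ ℚ.+ ℚ.∣ g i ∣    <⟨ ℚ.+-mono-< (f< i (⊑-weaken (ℕ.m≤m⊔n M N) M⊔N⊑i))
                                             (g< i (⊑-weaken (ℕ.m≤n⊔m M N) M⊔N⊑i)) ⟩
    ε ℚ.* ½ ℚ.+ ε ℚ.* ½        ≡⟨ half+half ε ⟩
    ε                          ∎
    where open ℚ.≤-Reasoning

  small-* : ∀ {g f} → Bounded g → Small f → Small (λ i → g i ℚ.* f i)
  small-* {g} {f} (mkBounded B 0<B M g<) f→0 .below ε 0<ε = M ℕ.⊔ N , λ i M⊔N⊑i → begin-strict
    ℚ.∣ g i ℚ.* f i ∣          ≡⟨ ℚ.∣p*q∣≡∣p∣*∣q∣ (g i) (f i) ⟩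
    ℚ.∣ g i ∣ ℚ.* ℚ.∣ f i ∣    ≤⟨ ℚ.*-monoʳ-≤-nonNeg ℚ.∣ f i ∣ {{ℚ.∣-∣-nonNeg (f i)}}
                                    (ℚ.<⇒≤ (g< i (⊑-weaken (ℕ.m≤m⊔n M N) M⊔N⊑i))) ⟩
    B ℚ.* ℚ.∣ f i ∣            <⟨ ℚ.*-monoʳ-<-pos B (f< i (⊑-weaken (ℕ.m≤n⊔m M N) M⊔N⊑i)) ⟩
    B ℚ.* (ℚ.1/ B ℚ.* ε)       ≡⟨ sym (ℚ.*-assoc B (ℚ.1/ B) ε) ⟩
    B ℚ.* ℚ.1/ B ℚ.* ε         ≡⟨ cong (ℚ._* ε) (ℚ.*-inverseʳ B) ⟩
    1ℚ ℚ.* ε                   ≡⟨ ℚ.*-identityˡ ε ⟩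
    ε                          ∎
    where
    open ℚ.≤-Reasoning
    instance
      B-positive : ℚ.Positive B
      B-positive = ℚ.positive 0<B
      B-nonZero : ℚ.NonZero B
      B-nonZero = ℚ.pos⇒nonZero B
    f-small = f→0 .below (ℚ.1/ B ℚ.* ε) (0<p*q (ℚ.positive⁻¹ (ℚ.1/ B) {{ℚ.1/pos⇒pos B}}) 0<ε)
    N  = proj₁ f-small
    f< = proj₂ f-small

private
  module L₁ = Limits {ℕ} ℕ._≤_ ℕ.≤-trans
  module L₂ = Limits {ℕ × ℕ} (λ N (m , n) → N ℕ.≤ m × N ℕ.≤ n)
    (λ M≤N (N≤m , N≤n) → ℕ.≤-trans M≤N N≤m , ℕ.≤-trans M≤N N≤n)

-- Real numbers are Cauchy sequences of rationals, compared by _≃_.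

Cauchy : (ℕ → ℚ) → Set
Cauchy x = ∀ ε → 0ℚ ℚ.< ε →
  ∃ λ N → ∀ m n → N ℕ.≤ m → N ℕ.≤ n → ℚ.∣ x m ℚ.- x n ∣ ℚ.< ε

record ℝ : Set where
  constructor mkℝ
  field
    seq    : ℕ → ℚ
    cauchy : Cauchy seq

open ℝ public

infix 4 _≃_ _≄_

record _≃_ (x y : ℝ) : Set where
  constructor mk≃
  field
    tends-to-0 : ∀ ε → 0ℚ ℚ.< ε →
      ∃ λ N → ∀ n → N ℕ.≤ n → ℚ.∣ seq x n ℚ.- seq y n ∣ ℚ.< ε

open _≃_ public

_≄_ : ℝ → ℝ → Set
x ≄ y = ¬ (x ≃ y)

private
  real : (x : ℕ → ℚ) → L₂.Small (λ (m , n) → x m ℚ.- x n) → ℝ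
  real x s = mkℝ x λ ε 0<ε → let N , h = L₂.below s ε 0<ε in
    N , λ m n N≤m N≤n → h (m , n) (N≤m , N≤n)

  small-tails : ∀ x → L₂.Small (λ (m , n) → seq x m ℚ.- seq x n)
  small-tails x .L₂.below ε 0<ε = let N , h = cauchy x ε 0<ε in
    N , λ (m , n) (N≤m , N≤n) → h m n N≤m N≤n

  equal : ∀ {x y} → L₁.Small (λ n → seq x n ℚ.- seq y n) → x ≃ y
  equal s = mk≃ (L₁.below s)

  small-difference : ∀ {x y} → x ≃ y → L₁.Small (λ n → seq x n ℚ.- seq y n)
  small-difference x≃y = L₁.mkSmall (tends-to-0 x≃y)

  bounded : ∀ x → L₁.Bounded (seq x)
  bounded x with cauchy x 1ℚ 0<1
  ... | N , h = L₁.mkBounded (1ℚ ℚ.+ ℚ.∣ seq x N ∣) 0<B N λ n N≤n → begin-strict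
    ℚ.∣ seq x n ∣                                     ≡⟨ cong ℚ.∣_∣ (solve 2 (λ a b → a := a :- b :+ b) refl (seq x n) (seq x N)) ⟩
    ℚ.∣ seq x n ℚ.- seq x N ℚ.+ seq x N ∣             ≤⟨ ℚ.∣p+q∣≤∣p∣+∣q∣ (seq x n ℚ.- seq x N) (seq x N) ⟩
    ℚ.∣ seq x n ℚ.- seq x N ∣ ℚ.+ ℚ.∣ seq x N ∣       <⟨ ℚ.+-monoˡ-< ℚ.∣ seq x N ∣ (h n N N≤n ℕ.≤-refl) ⟩
    1ℚ ℚ.+ ℚ.∣ seq x N ∣                              ∎
    where
    open ℚ.≤-Reasoning
    open +-*-Solver
    0<B : 0ℚ ℚ.< 1ℚ ℚ.+ ℚ.∣ seq x N ∣
    0<B = ℚ.+-mono-<-≤ 0<1 (ℚ.0≤∣p∣ (seq x N))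

  bounded₁ : ∀ x → L₂.Bounded (λ (m , n) → seq x m)
  bounded₁ x = let L₁.mkBounded B 0<B N h = bounded x in
    L₂.mkBounded B 0<B N λ (m , n) (N≤m , N≤n) → h m N≤m

  bounded₂ : ∀ x → L₂.Bounded (λ (m , n) → seq x n)
  bounded₂ x = let L₁.mkBounded B 0<B N h = bounded x in
    L₂.mkBounded B 0<B N λ (m , n) (N≤m , N≤n) → h n N≤n

  sum-diff : ∀ p q p′ q′ →
    p ℚ.+ q ℚ.- (p′ ℚ.+ q′) ≡ (p ℚ.- p′) ℚ.+ (q ℚ.- q′)
  sum-diff = solve 4 (λ a b c d → a :+ b :- (c :+ d) := (a :- c) :+ (b :- d)) refl
    where open +-*-Solver

  product-diff : ∀ p q p′ q′ →
    p ℚ.* q ℚ.- p′ ℚ.* q′ ≡ q ℚ.* (p ℚ.- p′) ℚ.+ p′ ℚ.* (q ℚ.- q′)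
  product-diff = solve 4 (λ a b c d →
    a :* b :- c :* d := b :* (a :- c) :+ c :* (b :- d)) refl
    where open +-*-Solver

  ∣neg-diff∣ : ∀ p q → ℚ.∣ ℚ.- p ℚ.- ℚ.- q ∣ ≡ ℚ.∣ p ℚ.- q ∣
  ∣neg-diff∣ p q = trans (cong ℚ.∣_∣ (sym (ℚ.neg-distrib-+ p (ℚ.- q)))) (ℚ.∣-p∣≡∣p∣ (p ℚ.- q))

infixl 6 _+_ _-_
infixl 7 _*_
infix  8 -_

-- Opaque so that conversion checking does not compare rational arithmetic
-- and convergence proofs.

opaque

  fromℚ : ℚ → ℝ
  fromℚ q = real (λ _ → q) (L₂.small-0 (λ _ → ℚ.+-inverseʳ q))

  _+_ : ℝ → ℝ → ℝ
  x + y = real (λ n → seq x n ℚ.+ seq y n)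
    (L₂.respects (λ (m , n) → sum-diff (seq x m) (seq y m) (seq x n) (seq y n))
      (L₂.small-+ (small-tails x) (small-tails y)))

  -_ : ℝ → ℝ
  - x = real (λ n → ℚ.- seq x n)
    (L₂.dominated (λ (m , n) → ℚ.≤-reflexive (∣neg-diff∣ (seq x m) (seq x n)))
      (small-tails x))

  _*_ : ℝ → ℝ → ℝ
  x * y = real (λ n → seq x n ℚ.* seq y n)
    (L₂.respects (λ (m , n) → product-diff (seq x m) (seq y m) (seq x n) (seq y n))
      (L₂.small-+ (L₂.small-* (bounded₁ y) (small-tails x))
                  (L₂.small-* (bounded₂ x) (small-tails y))))

  ∣_∣ : ℝ → ℝ
  ∣ x ∣ = real (λ n → ℚ.∣ seq x n ∣)
    (L₂.dominated (λ (m , n) → ∣∣p∣-∣q∣∣≤∣p-q∣ (seq x m) (seq x n))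
      (small-tails x))

0ℝ 1ℝ 2ℝ : ℝ
0ℝ = fromℚ 0ℚ
1ℝ = fromℚ 1ℚ
2ℝ = 1ℝ + 1ℝ

_-_ : ℝ → ℝ → ℝ
x - y = x + (- y)

private
  pointwise : ∀ {x y} → (∀ n → seq x n ≡ seq y n) → x ≃ y
  pointwise {x} {y} eq = equal (L₁.small-0 λ n →
    trans (cong (ℚ._- seq y n) (eq n)) (ℚ.+-inverseʳ (seq y n)))

  ≃-refl : ∀ {x} → x ≃ x
  ≃-refl = pointwise (λ _ → refl)

  ≃-sym : ∀ {x y} → x ≃ y → y ≃ x
  ≃-sym {x} {y} x≃y = equal (L₁.dominated
    (λ n → ℚ.≤-reflexive (∣p-q∣≡∣q-p∣ (seq y n) (seq x n))) (small-difference x≃y))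

  ≃-trans : ∀ {x y z} → x ≃ y → y ≃ z → x ≃ z
  ≃-trans {x} {y} {z} x≃y y≃z = equal (L₁.respects
    (λ n → solve 3 (λ a b c → a :- c := (a :- b) :+ (b :- c)) refl (seq x n) (seq y n) (seq z n))
    (L₁.small-+ (small-difference x≃y) (small-difference y≃z)))
    where open +-*-Solver

private opaque
  unfolding fromℚ _+_ -_ _*_

  +-cong : ∀ {x x′ y y′} → x ≃ x′ → y ≃ y′ → x + y ≃ x′ + y′
  +-cong {x} {x′} {y} {y′} p q = equal (L₁.respects
    (λ n → sum-diff (seq x n) (seq y n) (seq x′ n) (seq y′ n))
    (L₁.small-+ (small-difference p) (small-difference q)))

  -‿cong : ∀ {x y} → x ≃ y → - x ≃ - y
  -‿cong {x} {y} p = equal (L₁.dominated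
    (λ n → ℚ.≤-reflexive (∣neg-diff∣ (seq x n) (seq y n))) (small-difference p))

  *-cong : ∀ {x x′ y y′} → x ≃ x′ → y ≃ y′ → x * y ≃ x′ * y′
  *-cong {x} {x′} {y} {y′} p q = equal (L₁.respects
    (λ n → product-diff (seq x n) (seq y n) (seq x′ n) (seq y′ n))
    (L₁.small-+ (L₁.small-* (bounded y) (small-difference p)) (L₁.small-* (bounded x′) (small-difference q))))

  +-assoc : ∀ x y z → (x + y) + z ≃ x + (y + z)
  +-assoc x y z = pointwise λ n → ℚ.+-assoc (seq x n) (seq y n) (seq z n)

  +-comm : ∀ x y → x + y ≃ y + x
  +-comm x y = pointwise λ n → ℚ.+-comm (seq x n) (seq y n)

  +-identityˡ : ∀ x → 0ℝ + x ≃ x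
  +-identityˡ x = pointwise λ n → ℚ.+-identityˡ (seq x n)

  +-identityʳ : ∀ x → x + 0ℝ ≃ x
  +-identityʳ x = pointwise λ n → ℚ.+-identityʳ (seq x n)

  -‿inverseˡ : ∀ x → (- x) + x ≃ 0ℝ
  -‿inverseˡ x = pointwise λ n → ℚ.+-inverseˡ (seq x n)

  -‿inverseʳ : ∀ x → x + (- x) ≃ 0ℝ
  -‿inverseʳ x = pointwise λ n → ℚ.+-inverseʳ (seq x n)

  *-assoc : ∀ x y z → (x * y) * z ≃ x * (y * z)
  *-assoc x y z = pointwise λ n → ℚ.*-assoc (seq x n) (seq y n) (seq z n)

  *-comm : ∀ x y → x * y ≃ y * x
  *-comm x y = pointwise λ n → ℚ.*-comm (seq x n) (seq y n)

  *-identityˡ : ∀ x → 1ℝ * x ≃ x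
  *-identityˡ x = pointwise λ n → ℚ.*-identityˡ (seq x n)

  *-identityʳ : ∀ x → x * 1ℝ ≃ x
  *-identityʳ x = pointwise λ n → ℚ.*-identityʳ (seq x n)

  distribˡ : ∀ x y z → x * (y + z) ≃ x * y + x * z
  distribˡ x y z = pointwise λ n → ℚ.*-distribˡ-+ (seq x n) (seq y n) (seq z n)

  distribʳ : ∀ x y z → (y + z) * x ≃ y * x + z * x
  distribʳ x y z = pointwise λ n → ℚ.*-distribʳ-+ (seq x n) (seq y n) (seq z n)

ℝ-commutativeRing : CommutativeRing 0ℓ 0ℓ
ℝ-commutativeRing = record
  { Carrier = ℝ ; _≈_ = _≃_ ; _+_ = _+_ ; _*_ = _*_ ; -_ = -_ ; 0# = 0ℝ ; 1# = 1ℝ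
  ; isCommutativeRing = record
    { isRing = record
      { +-isAbelianGroup = record
        { isGroup = record
          { isMonoid = record
            { isSemigroup = record
              { isMagma = record
                { isEquivalence = record { refl = ≃-refl ; sym = ≃-sym ; trans = ≃-trans }
                ; ∙-cong = +-cong
                }
              ; assoc = +-assoc
              }
            ; identity = +-identityˡ , +-identityʳ
            }
          ; inverse = -‿inverseˡ , -‿inverseʳ
          ; ⁻¹-cong = -‿cong
          }
        ; comm = +-comm
        }
      ; *-cong = *-cong
      ; *-assoc = *-assoc
      ; *-identity = *-identityˡ , *-identityʳ
      ; distrib = distribˡ , distribʳ
      }
    ; *-comm = *-comm
    }
  }

open RawMonoidDefinitions (CommutativeRing.+-rawMonoid ℝ-commutativeRing) using (sum)

module Triangle (a₀ a₁ α β u v : ℝ) where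

  leftDiagonal : ℕ → ℝ
  leftDiagonal 0             = a₀
  leftDiagonal 1             = a₁
  leftDiagonal (suc (suc n)) = α * leftDiagonal (suc n) + β * leftDiagonal n

  entry : (n k : ℕ) → .(k ℕ.≤ n) → ℝ
  entry n       zero    _   = leftDiagonal n
  entry zero    (suc k) ()
  entry (suc n) (suc k) k<n =
    u * entry (suc n) k (ℕ.<⇒≤ k<n) + v * entry n k (s≤s⁻¹ k<n)

  rowSum : ℕ → ℝ
  rowSum n = sum {suc n} (λ k → entry n (toℕ k) (toℕ≤pred[n] k))

{-# OPTIONS --safe #-}

-- For fixed k the column (a_{n,k})_n inherits the recurrence of the left
-- diagonal, so s_{n+2} − α s_{n+1} − β s_n only involves entries next to the
-- hypotenuse.  The pair (a_{n,n}, a_{n+1,n}) evolves by the matrix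
--   ( v    u      )
--   ( uβ   uα + v )
-- of trace 𝒜 and determinant −ℬ, so by Cayley–Hamilton that difference
-- satisfies the recurrence with coefficients 𝒜 and ℬ.

module Submission where

open import Algebra.Bundles using (CommutativeRing)
import Algebra.Properties.Semiring.Sum as SemiringSum
import Algebra.Solver.Ring as RingSolver
open import Algebra.Solver.Ring.AlmostCommutativeRing
  using (fromCommutativeRing; _-Raw-AlmostCommutative⟶_)
open import Data.Fin.Base using (Fin; toℕ)
open import Data.Fin.Properties using (toℕ≤pred[n]; toℕ-fromℕ; toℕ-inject₁)
open import Data.Maybe.Base using (map)
open import Data.Nat.Base as ℕ using (ℕ; zero; suc; _≤_; _∸_; s≤s; s≤s⁻¹)
import Data.Nat.Properties as ℕ
open import Data.Product.Base using (_,_)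
open import Data.Rational.Base as ℚ using (1ℚ)
import Data.Rational.Properties as ℚ
open import Function.Base using (_∘_)
open import Relation.Binary.Consequences using (dec⇒weaklyDec)
open import Relation.Binary.PropositionalEquality as ≡ using (_≡_; cong; cong₂; subst)
import Relation.Binary.Reasoning.Setoid as SetoidReasoning
open import Defs

private
  module R = CommutativeRing ℝ-commutativeRing

open SemiringSum R.semiring
  using (sum; sum-cong-≋; sum-cong-≗; sum-init-last; ∑-distrib-+; *-distribˡ-sum)

seq-≗⇒≃ : ∀ {x y} → (∀ n → seq x n ≡ seq y n) → x ≃ y
seq-≗⇒≃ {x} {y} x≗y = mk≃ λ ε 0<ε → 0 , λ n _ →
  subst (λ p → ℚ.∣ p ∣ ℚ.< ε)
    (≡.sym (≡.trans (cong (ℚ._- seq y n) (x≗y n)) (ℚ.+-inverseʳ (seq y n)))) 0<ε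

opaque
  unfolding fromℚ _+_ _*_ -_

  -- Once the operations unfold, both sides have definitionally the same underlying sequence, so
  -- `refl` suffices at each index.
  fromℚ-homo-+ : ∀ p q → fromℚ (p ℚ.+ q) ≃ fromℚ p + fromℚ q
  fromℚ-homo-+ p q = seq-≗⇒≃ λ _ → ≡.refl

  fromℚ-homo-* : ∀ p q → fromℚ (p ℚ.* q) ≃ fromℚ p * fromℚ q
  fromℚ-homo-* p q = seq-≗⇒≃ λ _ → ≡.refl

  fromℚ-homo-‿- : ∀ p → fromℚ (ℚ.- p) ≃ - fromℚ p
  fromℚ-homo-‿- p = seq-≗⇒≃ λ _ → ≡.refl

-- Real equality is undecidable, so the solver normalises with rational
-- coefficients.

fromℚ-morphism : CommutativeRing.rawRing ℚ.+-*-commutativeRing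
  -Raw-AlmostCommutative⟶ fromCommutativeRing ℝ-commutativeRing
fromℚ-morphism = record
  { ⟦_⟧    = fromℚ
  ; +-homo = fromℚ-homo-+
  ; *-homo = fromℚ-homo-*
  ; -‿homo = fromℚ-homo-‿-
  ; 0-homo = R.refl
  ; 1-homo = R.refl
  }

open RingSolver _ _ fromℚ-morphism
  (λ p q → map (R.reflexive ∘ cong fromℚ) (dec⇒weaklyDec ℚ._≟_ p q))

-- Since the summand factors through `toℕ`, the `inject₁` and `fromℕ` produced by splitting off the
-- last term vanish, and sums of different lengths share one `f`.
sum-last : ∀ (f : ℕ → ℝ) n →
  sum {suc n} (f ∘ toℕ) ≃ sum {n} (f ∘ toℕ) + f n
sum-last f n = R.trans (sum-init-last (f ∘ toℕ))
  (R.+-cong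
    (R.reflexive (sum-cong-≗ (λ (k : Fin n) → cong f (toℕ-inject₁ k))))
    (R.reflexive (cong f (toℕ-fromℕ n))))

module Rows (a₀ a₁ α β u v : ℝ) where

  open Triangle a₀ a₁ α β u v
  open SetoidReasoning R.setoid

  𝒜 ℬ : ℝ
  𝒜 = u * α + 2ℝ * v
  ℬ = u * u * β - u * v * α - v * v

  -- The entries extended by 0 to k > n, which frees sums over k from the
  -- bound carried by `entry`.
  entry₀ : ℕ → ℕ → ℝ
  entry₀ n       zero    = leftDiagonal n
  entry₀ zero    (suc k) = 0ℝ
  entry₀ (suc n) (suc k) = u * entry₀ (suc n) k + v * entry₀ n k

  -- For k ≤ n neither recursion reaches the clause with value `0ℝ`, and the remaining clauses
  -- agree.
  entry≡entry₀ : ∀ n k .(k≤n : k ≤ n) → entry n k k≤n ≡ entry₀ n k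
  entry≡entry₀ n       zero    _   = ≡.refl
  entry≡entry₀ zero    (suc k) ()
  entry≡entry₀ (suc n) (suc k) k<n = cong₂ (λ x y → u * x + v * y)
    (entry≡entry₀ (suc n) k (ℕ.<⇒≤ k<n)) (entry≡entry₀ n k (s≤s⁻¹ k<n))

  rowSum₀ : ℕ → ℝ
  rowSum₀ n = sum {suc n} (entry₀ n ∘ toℕ)

  rowSum≡rowSum₀ : ∀ n → rowSum n ≡ rowSum₀ n
  rowSum≡rowSum₀ n = sum-cong-≗ λ k → entry≡entry₀ n (toℕ k) (toℕ≤pred[n] k)

  -- Each column is a fixed linear combination of the previous column and its shift, so a linear
  -- recurrence passes from column to column. The bound keeps even `entry₀ n k`, the entry in the
  -- shortest row, inside the triangle.
  column-recurrence : ∀ n k → k ≤ n →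
    entry₀ (2 ℕ.+ n) k ≃ α * entry₀ (1 ℕ.+ n) k + β * entry₀ n k
  column-recurrence n       zero    _   = R.refl
  column-recurrence (suc n) (suc k) k<n = begin
    u * entry₀ (3 ℕ.+ n) k + v * entry₀ (2 ℕ.+ n) k
      ≈⟨ R.+-cong (R.*-congˡ (column-recurrence (suc n) k (ℕ.<⇒≤ k<n)))
                  (R.*-congˡ (column-recurrence n k (s≤s⁻¹ k<n))) ⟩
    u * (α * x + β * y) + v * (α * y + β * z)
      ≈⟨ solve 7 (λ α β u v x y z →
           u :* (α :* x :+ β :* y) :+ v :* (α :* y :+ β :* z)
           := α :* (u :* x :+ v :* y) :+ β :* (u :* y :+ v :* z))
         R.refl α β u v x y z ⟩
    α * (u * x + v * y) + β * (u * y + v * z) ∎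
    where
    x = entry₀ (2 ℕ.+ n) k
    y = entry₀ (1 ℕ.+ n) k
    z = entry₀ n k

  diagonal : ℕ → ℝ
  diagonal n = entry₀ n n

  subdiagonal : ℕ → ℝ
  subdiagonal n = entry₀ (suc n) n

  -- Second row of the matrix: `column-recurrence` brings a_{n+2,n} back to the two diagonals. The
  -- first row, a_{n+1,n+1} = u a_{n+1,n} + v a_{n,n}, holds by definition.
  subdiagonal-suc : ∀ n →
    subdiagonal (suc n) ≃ u * (α * subdiagonal n + β * diagonal n) + v * subdiagonal n
  subdiagonal-suc n = R.+-congʳ (R.*-congˡ (column-recurrence n n ℕ.≤-refl))

  diagonal-recurrence : ∀ n →
    diagonal (2 ℕ.+ n) ≃ 𝒜 * diagonal (1 ℕ.+ n) + ℬ * diagonal n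
  diagonal-recurrence n = begin
    u * subdiagonal (suc n) + v * diagonal (suc n)
      ≈⟨ R.+-congʳ (R.*-congˡ (subdiagonal-suc n)) ⟩
    u * (u * (α * f + β * d) + v * f) + v * (u * f + v * d)
      ≈⟨ solve 6 (λ α β u v d f →
           u :* (u :* (α :* f :+ β :* d) :+ v :* f) :+ v :* (u :* f :+ v :* d)
           -- The sum of two constants mirrors the definition of `2ℝ`, so the result matches `𝒜`
           -- definitionally.
           := (u :* α :+ (con 1ℚ :+ con 1ℚ) :* v) :* (u :* f :+ v :* d)
              :+ (u :* u :* β :- u :* v :* α :- v :* v) :* d)
         R.refl α β u v d f ⟩
    𝒜 * (u * f + v * d) + ℬ * d ∎
    where
    d = diagonal n
    f = subdiagonal n

  subdiagonal-recurrence : ∀ n →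
    subdiagonal (2 ℕ.+ n) ≃ 𝒜 * subdiagonal (1 ℕ.+ n) + ℬ * subdiagonal n
  subdiagonal-recurrence n = begin
    subdiagonal (2 ℕ.+ n)
      ≈⟨ subdiagonal-suc (suc n) ⟩
    u * (α * subdiagonal (suc n) + β * (u * f + v * d)) + v * subdiagonal (suc n)
      ≈⟨ R.+-cong (R.*-congˡ (R.+-congʳ (R.*-congˡ (subdiagonal-suc n))))
                  (R.*-congˡ (subdiagonal-suc n)) ⟩
    u * (α * f′ + β * (u * f + v * d)) + v * f′
      ≈⟨ solve 6 (λ α β u v d f →
           let f′ = u :* (α :* f :+ β :* d) :+ v :* f in
           u :* (α :* f′ :+ β :* (u :* f :+ v :* d)) :+ v :* f′
           := (u :* α :+ (con 1ℚ :+ con 1ℚ) :* v) :* f′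
              :+ (u :* u :* β :- u :* v :* α :- v :* v) :* f)
         R.refl α β u v d f ⟩
    𝒜 * f′ + ℬ * f
      ≈⟨ R.+-congʳ (R.*-congˡ (subdiagonal-suc n)) ⟨
    𝒜 * subdiagonal (suc n) + ℬ * f ∎
    where
    d  = diagonal n
    f  = subdiagonal n
    f′ = u * (α * f + β * d) + v * f

  defect : ℕ → ℝ
  defect n = rowSum₀ (2 ℕ.+ n) - α * rowSum₀ (1 ℕ.+ n) - β * rowSum₀ n

  partialRowSum-recurrence : ∀ n →
    sum {suc n} (entry₀ (2 ℕ.+ n) ∘ toℕ)
    ≃ α * sum {suc n} (entry₀ (1 ℕ.+ n) ∘ toℕ) + β * rowSum₀ n
  partialRowSum-recurrence n = begin
    sum {suc n} (entry₀ (2 ℕ.+ n) ∘ toℕ)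
      ≈⟨ sum-cong-≋ (λ (k : Fin (suc n)) → column-recurrence n (toℕ k) (toℕ≤pred[n] k)) ⟩
    sum {suc n} (λ k → α * x k + β * y k)
      ≈⟨ ∑-distrib-+ (λ k → α * x k) (λ k → β * y k) ⟩
    sum (λ k → α * x k) + sum (λ k → β * y k)
      ≈⟨ R.+-cong (*-distribˡ-sum α x) (*-distribˡ-sum β y) ⟨
    α * sum x + β * sum y ∎
    where
    x y : Fin (suc n) → ℝ
    x = entry₀ (1 ℕ.+ n) ∘ toℕ
    y = entry₀ n ∘ toℕ

  -- Over the common columns 0 to n the three rows cancel by `partialRowSum-recurrence`. Row n+2 has
  -- two further entries and row n+1 has one.
  defect-boundary : ∀ n →
    defect n ≃ subdiagonal (1 ℕ.+ n) + diagonal (2 ℕ.+ n) - α * diagonal (1 ℕ.+ n)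
  defect-boundary n = begin
    rowSum₀ (2 ℕ.+ n) - α * rowSum₀ (1 ℕ.+ n) - β * z
      ≈⟨ R.+-congʳ (R.+-cong
           (R.trans (sum-last (entry₀ (2 ℕ.+ n)) (2 ℕ.+ n))
             (R.+-congʳ (R.trans (sum-last (entry₀ (2 ℕ.+ n)) (1 ℕ.+ n))
               (R.+-congʳ (partialRowSum-recurrence n)))))
           (R.-‿cong (R.*-congˡ (sum-last (entry₀ (1 ℕ.+ n)) (1 ℕ.+ n))))) ⟩
    α * y + β * z + f + e - α * (y + d) - β * z
      ≈⟨ solve 7 (λ α β y z d e f →
           α :* y :+ β :* z :+ f :+ e :- α :* (y :+ d) :- β :* z := f :+ e :- α :* d)
         R.refl α β y z d e f ⟩
    f + e - α * d ∎
    where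
    y = sum {suc n} (entry₀ (1 ℕ.+ n) ∘ toℕ)
    z = rowSum₀ n
    d = diagonal (1 ℕ.+ n)
    e = diagonal (2 ℕ.+ n)
    f = subdiagonal (1 ℕ.+ n)

  -- By `defect-boundary` the defect is a fixed linear combination of shifts of two sequences that
  -- obey this recurrence.
  defect-recurrence : ∀ n →
    defect (2 ℕ.+ n) ≃ 𝒜 * defect (1 ℕ.+ n) + ℬ * defect n
  defect-recurrence n = begin
    defect (2 ℕ.+ n)
      ≈⟨ defect-boundary (2 ℕ.+ n) ⟩
    subdiagonal (3 ℕ.+ n) + diagonal (4 ℕ.+ n) - α * diagonal (3 ℕ.+ n)
      ≈⟨ R.+-cong
           (R.+-cong (subdiagonal-recurrence (1 ℕ.+ n)) (diagonal-recurrence (2 ℕ.+ n)))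
           (R.-‿cong (R.*-congˡ (diagonal-recurrence (1 ℕ.+ n)))) ⟩
    (𝒜 * f′ + ℬ * f) + (𝒜 * d″ + ℬ * d′) - α * (𝒜 * d′ + ℬ * d)
      ≈⟨ solve 8 (λ α 𝒜 ℬ d d′ d″ f f′ →
           (𝒜 :* f′ :+ ℬ :* f) :+ (𝒜 :* d″ :+ ℬ :* d′) :- α :* (𝒜 :* d′ :+ ℬ :* d)
           := 𝒜 :* (f′ :+ d″ :- α :* d′) :+ ℬ :* (f :+ d′ :- α :* d))
         R.refl α 𝒜 ℬ d d′ d″ f f′ ⟩
    𝒜 * (f′ + d″ - α * d′) + ℬ * (f + d′ - α * d)
      ≈⟨ R.+-cong (R.*-congˡ (defect-boundary (1 ℕ.+ n)))
                  (R.*-congˡ (defect-boundary n)) ⟨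
    𝒜 * defect (1 ℕ.+ n) + ℬ * defect n ∎
    where
    d  = diagonal (1 ℕ.+ n)
    d′ = diagonal (2 ℕ.+ n)
    d″ = diagonal (3 ℕ.+ n)
    f  = subdiagonal (1 ℕ.+ n)
    f′ = subdiagonal (2 ℕ.+ n)

  -- The characteristic polynomial is (x² - αx - β)(x² - 𝒜x - ℬ): `defect` applies the first factor,
  -- and the second annihilates the result.
  rowSum₀-recurrence : ∀ n →
    rowSum₀ (4 ℕ.+ n) ≃ (α + 𝒜) * rowSum₀ (3 ℕ.+ n)
                        + (β - α * 𝒜 + ℬ) * rowSum₀ (2 ℕ.+ n)
                        - (α * ℬ + β * 𝒜) * rowSum₀ (1 ℕ.+ n)
                        - β * ℬ * rowSum₀ n
  rowSum₀-recurrence n = begin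
    s₄
      -- The trivial identity makes `defect (2 ℕ.+ n)` appear as the last bracket.
      ≈⟨ solve 5 (λ α β s₂ s₃ s₄ →
           s₄ := α :* s₃ :+ β :* s₂ :+ (s₄ :- α :* s₃ :- β :* s₂))
         R.refl α β s₂ s₃ s₄ ⟩
    α * s₃ + β * s₂ + defect (2 ℕ.+ n)
      ≈⟨ R.+-congˡ (defect-recurrence n) ⟩
    α * s₃ + β * s₂ + (𝒜 * (s₃ - α * s₂ - β * s₁) + ℬ * (s₂ - α * s₁ - β * s₀))
      ≈⟨ solve 8 (λ α β 𝒜 ℬ s₀ s₁ s₂ s₃ →
           α :* s₃ :+ β :* s₂
             :+ (𝒜 :* (s₃ :- α :* s₂ :- β :* s₁) :+ ℬ :* (s₂ :- α :* s₁ :- β :* s₀))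
           := (α :+ 𝒜) :* s₃ :+ (β :- α :* 𝒜 :+ ℬ) :* s₂
              :- (α :* ℬ :+ β :* 𝒜) :* s₁ :- β :* ℬ :* s₀)
         R.refl α β 𝒜 ℬ s₀ s₁ s₂ s₃ ⟩
    (α + 𝒜) * s₃ + (β - α * 𝒜 + ℬ) * s₂ - (α * ℬ + β * 𝒜) * s₁ - β * ℬ * s₀ ∎
    where
    s₀ = rowSum₀ n
    s₁ = rowSum₀ (1 ℕ.+ n)
    s₂ = rowSum₀ (2 ℕ.+ n)
    s₃ = rowSum₀ (3 ℕ.+ n)
    s₄ = rowSum₀ (4 ℕ.+ n)

  rowSum-recurrence : ∀ n →
    rowSum (4 ℕ.+ n) ≃ (α + 𝒜) * rowSum (3 ℕ.+ n)
                       + (β - α * 𝒜 + ℬ) * rowSum (2 ℕ.+ n)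
                       - (α * ℬ + β * 𝒜) * rowSum (1 ℕ.+ n)
                       - β * ℬ * rowSum n
  rowSum-recurrence n
    rewrite rowSum≡rowSum₀ (4 ℕ.+ n) | rowSum≡rowSum₀ (3 ℕ.+ n)
          | rowSum≡rowSum₀ (2 ℕ.+ n) | rowSum≡rowSum₀ (1 ℕ.+ n)
          | rowSum≡rowSum₀ n
    = rowSum₀-recurrence n

theorem5 :
    (a₀ a₁ α β u v : ℝ) →
    α * β ≄ 0ℝ →
    u * v ≄ 0ℝ →
    ∣ a₀ ∣ + ∣ a₁ ∣ ≄ 0ℝ →
    let s = Triangle.rowSum a₀ a₁ α β u v
        𝒜 = u * α + 2ℝ * v
        ℬ = u * u * β - u * v * α - v * v
    in (n : ℕ) → 4 ≤ n →
       s n ≃ (α + 𝒜) * s (n ∸ 1)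
             + (β - α * 𝒜 + ℬ) * s (n ∸ 2)
             - (α * ℬ + β * 𝒜) * s (n ∸ 3)
             - β * ℬ * s (n ∸ 4)
-- Matching on `4 ≤ n` exposes four successors, so each truncated subtraction computes exactly.
theorem5 a₀ a₁ α β u v _ _ _ (suc (suc (suc (suc n)))) (s≤s (s≤s (s≤s (s≤s _)))) =
  Rows.rowSum-recurrence a₀ a₁ α β u v n
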